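{- Every $n\times n$ Latin square $L$ has a greedy defining set of size at most $n^2-\frac{n\log (4n)}{4}$.
   Context: An $n\times n$ Latin square on $\{1,\dots,n\}$ is identified with a proper $n$-coloring of $K_n\Box K_n$ (cell $(i,j)$ colored by its entry), with cells ordered lexicographically: $(i,j)<(i',j')$ iff $i<i'$, or $i=i'$ and $j<j'$. A set $D$ of cells is a greedy defining set of $L$ if, pre-coloring the cells of $D$ with their entries in $L$ and then processing the remaining cells in lexicographic order, giving each the smallest positive integer not already used by a colored cell in the same row or column (cells of $D$ count as colored from the start), produces exactly $L$. Here $\log$ is the natural logarithm. -}

module Defs where

open import Data.Nat using (ℕ; zero; suc; _+_; _*_; _^_; _≤_; _∸_)
open import Data.Nat using (_!)
open import Data.Nat.ListAction using (sum)
open import Data.Fin using (Fin; toℕ)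
import Data.Fin as F
open import Data.Bool using (Bool; true; false; if_then_else_)
open import Data.Maybe using (Maybe; just; nothing)
open import Data.List using (List; []; _∷_; map; concatMap; allFin; foldl; length; filter; upTo; _++_)
open import Data.List.Membership.DecPropositional (Data.Nat._≟_) using (_∈?_)
open import Data.Product using (_×_; _,_; ∃-syntax)
open import Relation.Nullary using (yes; no; does)
open import Function.Definitions using (Injective)
open import Relation.Binary.PropositionalEquality using (_≡_)

Square : ℕ → Set
Square n = Fin n → Fin n → Fin n

entry : ∀ {n} → Square n → Fin n → Fin n → ℕ
entry L i j = suc (toℕ (L i j))

IsLatin : ∀ {n} → Square n → Set
IsLatin {n} L = (∀ i → Injective _≡_ _≡_ (L i))
              × (∀ j → Injective _≡_ _≡_ (λ i → L i j))

cells : (n : ℕ) → List (Fin n × Fin n)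
cells n = concatMap (λ i → map (λ j → (i , j)) (allFin n)) (allFin n)

CellSet : ℕ → Set
CellSet n = Fin n → Fin n → Bool

size : ∀ {n} → CellSet n → ℕ
size {n} D = length (filter (λ c → D (Data.Product.proj₁ c) (Data.Product.proj₂ c) Data.Bool.≟ true) (cells n))

searchFrom : ℕ → ℕ → List ℕ → ℕ
searchFrom zero    c xs = c
searchFrom (suc f) c xs = if does (c ∈? xs) then searchFrom f (suc c) xs else c

-- smallest positive integer not in xs (among 1..length xs + 1 one is missing)
mexPos : List ℕ → ℕ
mexPos xs = searchFrom (suc (length xs)) 1 xs

Coloring : ℕ → Set
Coloring n = Fin n → Fin n → Maybe ℕ

justs : List (Maybe ℕ) → List ℕ
justs [] = []
justs (just x ∷ ms) = x ∷ justs ms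
justs (nothing ∷ ms) = justs ms

usedAt : ∀ {n} → Coloring n → Fin n → Fin n → List ℕ
usedAt {n} col i j = justs (map (λ j' → col i j') (allFin n) ++ map (λ i' → col i' j) (allFin n))

update : ∀ {n} → Coloring n → Fin n → Fin n → ℕ → Coloring n
update col i j v i' j' with i F.≟ i' | j F.≟ j'
... | yes _ | yes _ = just v
... | _     | _     = col i' j'

initial : ∀ {n} → Square n → CellSet n → Coloring n
initial L D i j = if D i j then just (entry L i j) else nothing

greedyStep : ∀ {n} → CellSet n → Coloring n → Fin n × Fin n → Coloring n
greedyStep D col (i , j) = if D i j then col else update col i j (mexPos (usedAt col i j))

greedy : ∀ {n} → Square n → CellSet n → Coloring n
greedy {n} L D = foldl (greedyStep D) (initial L D) (cells n)

IsGreedyDefiningSet : ∀ {n} → Square n → CellSet n → Set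
IsGreedyDefiningSet L D = ∀ i j → greedy L D i j ≡ just (entry L i j)

-- Partial sum  Σ_{j=0}^{J} x^j · J!/j!  (= J! · Σ_{j≤J} x^j/j!), computed as
-- Σ_{j≤J} x^j · (j+1)(j+2)⋯J.
-- risingFrom j k = (j+1)(j+2)⋯(j+k); so risingFrom j (J ∸ j) = J!/j! for j ≤ J
risingFrom : ℕ → ℕ → ℕ
risingFrom j zero = 1
risingFrom j (suc k) = risingFrom j k * (j + suc k)

expPartialScaled : ℕ → ℕ → ℕ
expPartialScaled x J = sum (map (λ j → x ^ j * risingFrom j (J ∸ j)) (upTo (suc J)))

-- "m ≥ n·log(4n)/4", i.e. e^(4m) ≥ (4n)^n, expressed by partial sums of the
-- exponential series: ∃ J, Σ_{j≤J} (4m)^j / j! ≥ (4n)^n   (multiplied by J!).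
AtLeastQuarterNLog4N : ℕ → ℕ → Set
AtLeastQuarterNLog4N n m = ∃[ J ] ((4 * n) ^ n * (J !) ≤ expPartialScaled (4 * m) J)

{-# OPTIONS --safe #-}

-- Let S be the complement of D.  The greedy colouring goes wrong at a cell
-- (i , j) of S only if some smaller colour c occurs in row i at a later cell
-- (i , j') of S and in column j at a later cell (i' , j) of S.  So it is enough
-- that S contains no two cells (i , j), (i , j') with j < j' such that the entry
-- of (i , j') occurs below (i , j) in column j.  This condition involves one
-- row at a time, and a given cell excludes at most n - 1 - i cells to its right,
-- so repeatedly keeping the leftmost cell and discarding those it excludes
-- leaves at least n / (n - i) cells in row i.  Summing over the rows,
-- |S| ≥ n (1 + 1/2 + ⋯ + 1/n), and grouping the terms dyadically gives
-- 2 |S| ≥ n (k + 2) whenever 2 ^ k ≤ n.  The exponential series at x = 4 |S| is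
-- bounded below by its single term x ^ x / x! ≥ 2 ^ (x - 1).

module Submission where

open import Defs
open import Data.Nat using (ℕ; zero; suc; _+_; _∸_; _*_; _^_; _≤_; _<_; _!; z≤n; s≤s)
open import Data.Nat.Properties
open import Data.Nat.ListAction using (sum)
open import Data.Nat.Tactic.RingSolver using (solve-∀)
open import Data.Bool using (true; false; not)
import Data.Bool.Properties as Bool
open import Data.Fin using (Fin; toℕ; fromℕ<; _↑ʳ_; zero; suc)
import Data.Fin as Fin
import Data.Fin.Properties as Fin
open import Data.List using (List; []; _∷_; _++_; map; concatMap; filter; length; tabulate; allFin; upTo; drop; lookup; foldl)
open import Data.List.Properties using (length-++; length-map; length-tabulate; length-drop; length-filter; length-upTo; filter-++; map-tabulate)
open import Data.List.Membership.Propositional using (_∈_; _∉_)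
open import Data.List.Membership.Propositional.Properties using (∈-map⁺; ∈-map⁻; ∈-filter⁺; ∈-filter⁻; ∈-lookup; ∈-allFin; ∈-tabulate⁺; ∈-upTo⁺; ∈-upTo⁻; ∈-++⁺ˡ; ∈-++⁺ʳ; ∈-++⁻; ∈-concat⁺′)
open import Data.List.Membership.Setoid.Properties using (index-injective)
import Data.List.Membership.DecPropositional as DecMembership
open import Data.List.Relation.Unary.All as All using (All; []; _∷_)
import Data.List.Relation.Unary.All.Properties as All
open import Data.List.Relation.Unary.AllPairs as AllPairs using (AllPairs; []; _∷_)
import Data.List.Relation.Unary.AllPairs.Properties as AllPairs
open import Data.List.Relation.Unary.Any using (here; there; index)
open import Data.List.Relation.Unary.Unique.Propositional using (Unique)
import Data.List.Relation.Unary.Unique.Propositional.Properties as Unique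
open import Data.Maybe using (just; nothing)
open import Data.Maybe.Properties using (just-injective)
open import Data.Product using (Σ; ∃; ∃-syntax; _×_; _,_; proj₁; proj₂)
open import Data.Product.Properties using (≡-dec)
open import Data.Sum using (_⊎_; inj₁; inj₂; [_,_]′)
open import Function using (_∘_; id)
open import Function.Definitions using (Injective)
open import Level using (0ℓ)
open import Relation.Binary as Binary using (Rel)
open import Relation.Binary.PropositionalEquality
open import Relation.Nullary using (¬_; yes; no; does; ¬?; contradiction)
open import Relation.Nullary.Decidable using (dec-true)
open import Relation.Unary using (Pred; Decidable)

private
  variable
    A B : Set
    n : ℕ

-- Lists

lookup-injective : {xs : List A} → Unique xs → Injective _≡_ _≡_ (lookup xs)
lookup-injective (_ ∷ _) {zero} {zero} _ = refl
lookup-injective (x∉ ∷ _) {zero} {suc j} eq = contradiction eq (All.lookup x∉ (∈-lookup j))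
lookup-injective (x∉ ∷ _) {suc i} {zero} eq = contradiction (sym eq) (All.lookup x∉ (∈-lookup i))
lookup-injective (_ ∷ u) {suc i} {suc j} eq = cong suc (lookup-injective u eq)

-- Pigeonhole: since `xs` has no repetitions, sending each of its positions to a position of the
-- same element in `ys` is injective.
unique-⊆⇒length≤ : {xs ys : List A} → Unique xs → (∀ {x} → x ∈ xs → x ∈ ys) → length xs ≤ length ys
unique-⊆⇒length≤ {xs = xs} u sub = Fin.injective⇒≤ {f = λ i → index (sub (∈-lookup {xs = xs} i))} λ {i} {j} eq →
  lookup-injective u (index-injective (setoid _) (sub (∈-lookup i)) (sub (∈-lookup j)) eq)

length-filter-complement : {P : Pred A 0ℓ} (P? : Decidable P) (xs : List A) →
  length (filter P? xs) + length (filter (¬? ∘ P?) xs) ≡ length xs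
length-filter-complement P? [] = refl
length-filter-complement P? (x ∷ xs) with P? x
... | yes _ = cong suc (length-filter-complement P? xs)
... | no _ = trans (+-suc _ _) (cong suc (length-filter-complement P? xs))

length-filter-concatMap : {P : Pred B 0ℓ} (P? : Decidable P) (f : A → List B) (xs : List A) →
  length (filter P? (concatMap f xs)) ≡ sum (map (length ∘ filter P? ∘ f) xs)
length-filter-concatMap P? f [] = refl
length-filter-concatMap P? f (x ∷ xs) = begin
  length (filter P? (f x ++ concatMap f xs))                        ≡⟨ cong length (filter-++ P? (f x) _) ⟩
  length (filter P? (f x) ++ filter P? (concatMap f xs))            ≡⟨ length-++ (filter P? (f x)) ⟩
  length (filter P? (f x)) + length (filter P? (concatMap f xs))    ≡⟨ cong (length (filter P? (f x)) +_) (length-filter-concatMap P? f xs) ⟩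
  length (filter P? (f x)) + sum (map (length ∘ filter P? ∘ f) xs)  ∎
  where open ≡-Reasoning

AllPairs-∈ : {R : Rel A 0ℓ} {xs : List A} {x y : A} → AllPairs R xs → x ∈ xs → y ∈ xs → x ≡ y ⊎ R x y ⊎ R y x
AllPairs-∈ (_ ∷ _) (here refl) (here refl) = inj₁ refl
AllPairs-∈ (r ∷ _) (here refl) (there y∈) = inj₂ (inj₁ (All.lookup r y∈))
AllPairs-∈ (r ∷ _) (there x∈) (here refl) = inj₂ (inj₂ (All.lookup r x∈))
AllPairs-∈ (_ ∷ rs) (there x∈) (there y∈) = AllPairs-∈ rs x∈ y∈

∈-sum : {x : ℕ} {xs : List ℕ} → x ∈ xs → x ≤ sum xs
∈-sum {xs = x ∷ xs} (here refl) = m≤m+n x (sum xs)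
∈-sum {xs = x ∷ xs} (there p) = m≤n⇒m≤o+n x (∈-sum p)

sum-tabulate-mono : {f g : Fin n → ℕ} → (∀ i → f i ≤ g i) → sum (tabulate f) ≤ sum (tabulate g)
sum-tabulate-mono {zero} _ = z≤n
sum-tabulate-mono {suc n} f≤g = +-mono-≤ (f≤g zero) (sum-tabulate-mono (f≤g ∘ suc))

∈-drop-tabulate : (f : Fin n → A) {i j : Fin n} → i Fin.< j → f j ∈ drop (suc (toℕ i)) (tabulate f)
∈-drop-tabulate f {zero} {suc j} _ = ∈-tabulate⁺ {f = f ∘ suc} j
∈-drop-tabulate f {suc i} {suc j} (s≤s i<j) = ∈-drop-tabulate (f ∘ suc) i<j

-- Independent sets

module _ {Q R : Rel A 0ℓ} (R? : Binary.Decidable R) (d : ℕ)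
         (degree : ∀ x {ys} → AllPairs Q ys → length (filter (R? x) ys) ≤ d) where

  -- Only the out-degree of R is bounded, but all edges at the head of a
  -- Q-sorted list go from the head to the tail.
  private
    independent-fuel : ∀ k xs → length xs ≤ k → AllPairs Q xs →
      Σ (List A) λ S → (∀ {x} → x ∈ S → x ∈ xs) × AllPairs (λ x y → Q x y × ¬ R x y) S × length xs ≤ suc d * length S
    independent-fuel k [] _ _ = [] , id , [] , z≤n
    independent-fuel (suc k) (x ∷ xs) (s≤s len) (q ∷ qs)
      with S , S⊆ , ind , large ← independent-fuel k (filter (¬? ∘ R? x) xs)
             (≤-trans (length-filter (¬? ∘ R? x) xs) len) (AllPairs.filter⁺ (¬? ∘ R? x) qs)
      = x ∷ S
      , (λ { (here eq) → here eq ; (there y∈S) → there (proj₁ (S⊆xs y∈S)) })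
      , All.tabulate (λ y∈S → All.lookup q (proj₁ (S⊆xs y∈S)) , proj₂ (S⊆xs y∈S)) ∷ ind
      , bound
      where
      S⊆xs : ∀ {y} → y ∈ S → y ∈ xs × ¬ R x y
      S⊆xs y∈S = ∈-filter⁻ (¬? ∘ R? x) (S⊆ y∈S)
      open ≤-Reasoning
      -- The one new element of the independent set pays for `x` and for the at most `d` elements
      -- that `x` excludes.
      bound : suc (length xs) ≤ suc d * suc (length S)
      bound = begin
        suc (length xs)                                                       ≡⟨ cong suc (length-filter-complement (R? x) xs) ⟨
        suc (length (filter (R? x) xs) + length (filter (¬? ∘ R? x) xs))      ≤⟨ s≤s (+-mono-≤ (degree x qs) large) ⟩
        suc d + suc d * length S                                              ≡⟨ *-suc (suc d) (length S) ⟨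
        suc d * suc (length S)                                                ∎

  independent : ∀ xs → AllPairs Q xs →
    Σ (List A) λ S → (∀ {x} → x ∈ S → x ∈ xs) × AllPairs (λ x y → Q x y × ¬ R x y) S × length xs ≤ suc d * length S
  independent xs = independent-fuel (length xs) xs ≤-refl

-- The cells left uncoloured in a row

below : Square n → Fin n → Fin n → List (Fin n)
below {n} L i j = map (λ i' → L i' j) (drop (suc (toℕ i)) (allFin n))

<-sorted⇒unique : {xs : List (Fin n)} → AllPairs Fin._<_ xs → Unique xs
<-sorted⇒unique = AllPairs.map Fin.<⇒≢

allFin-sorted : ∀ n → AllPairs Fin._<_ (allFin n)
allFin-sorted n = AllPairs.tabulate⁺-< id

-- The second component is the lower bound `n / (n - i)` on the length, with the denominator
-- cleared.
RowSet : Square n → Fin n → List (Fin n) → Set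
RowSet {n} L i S =
  AllPairs (λ j j' → j Fin.< j' × L i j' ∉ below L i j) S × n ≤ (n ∸ toℕ i) * length S

rowSet : (L : Square n) → IsLatin L → ∀ i → ∃ (RowSet L i)
rowSet {n} L (row , _) i =
  let S , _ , ind , large = independent (λ j j' → L i j' ∈? below L i j) (n ∸ suc (toℕ i)) degree (allFin n) (allFin-sorted n)
  -- Here `suc d` with `d = n - 1 - i` equals `n - i`, because `toℕ i < n`.
  in S , ind , subst₂ _≤_ (length-tabulate {n = n} id) (cong (_* length S) (sym (+-∸-assoc 1 (Fin.toℕ<n i)))) large
  where
  open DecMembership (Fin._≟_ {n}) using (_∈?_)
  open ≤-Reasoning
  -- The entries of a row are distinct, so the excluded cells inject through their entries into
  -- `below L i j`, which has length `n - 1 - i`.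
  degree : ∀ j {js} → AllPairs Fin._<_ js → length (filter (λ j' → L i j' ∈? below L i j) js) ≤ n ∸ suc (toℕ i)
  degree j {js} sorted = begin
    length js'                                 ≡⟨ length-map (L i) js' ⟨
    length (map (L i) js')                     ≤⟨ unique-⊆⇒length≤ (Unique.map⁺ (row i) (Unique.filter⁺ R? (<-sorted⇒unique sorted))) sub ⟩
    length (below L i j)                       ≡⟨ length-map _ (drop (suc (toℕ i)) (allFin n)) ⟩
    length (drop (suc (toℕ i)) (allFin n))     ≡⟨ length-drop (suc (toℕ i)) (allFin n) ⟩
    length (allFin n) ∸ suc (toℕ i)            ≡⟨ cong (_∸ suc (toℕ i)) (length-tabulate {n = n} id) ⟩
    n ∸ suc (toℕ i)                            ∎
    where
    R? : Decidable (λ j' → L i j' ∈ below L i j)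
    R? j' = L i j' ∈? below L i j
    js' : List (Fin n)
    js' = filter R? js
    sub : ∀ {v} → v ∈ map (L i) js' → v ∈ below L i j
    sub v∈ with _ , j'∈ , refl ← ∈-map⁻ (L i) v∈ = proj₂ (∈-filter⁻ R? {xs = js} j'∈)

-- The greedy colouring

searchFrom-least : ∀ f c e xs → c ≤ e → e ≤ c + f → (∀ v → c ≤ v → v < e → v ∈ xs) → e ∉ xs → searchFrom f c xs ≡ e
-- Without fuel the search returns `c`, and `e ≤ c + 0` forces `c ≡ e`.
searchFrom-least zero c e xs c≤e e≤c+0 _ _ = ≤-antisym c≤e (subst (e ≤_) (+-identityʳ c) e≤c+0)
searchFrom-least (suc f) c e xs c≤e e≤c+f smaller e∉ with c ∈ℕ? xs
  where open DecMembership _≟_ using () renaming (_∈?_ to _∈ℕ?_)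
... | yes c∈ = searchFrom-least f (suc c) e xs (≤∧≢⇒< c≤e λ { refl → e∉ c∈ }) (subst (e ≤_) (+-suc c f) e≤c+f)
                 (λ v c<v → smaller v (<⇒≤ c<v)) e∉
... | no c∉ = [ (λ c<e → contradiction (smaller c ≤-refl c<e) c∉) , id ]′ (m≤n⇒m<n∨m≡n c≤e)

mexPos-least : ∀ e xs → (∀ v → v < e → suc v ∈ xs) → suc e ∉ xs → mexPos xs ≡ suc e
mexPos-least e xs smaller e∉ = searchFrom-least (suc (length xs)) 1 (suc e) xs (s≤s z≤n) (s≤s (m≤n⇒m≤1+n e≤length))
  (λ { (suc v) _ (s≤s v<e) → smaller v v<e }) e∉
  where
  open ≤-Reasoning
  -- The numbers from 1 to `e` are distinct members of `xs`, so the fuel `suc (length xs)` lets the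
  -- search reach `suc e`.
  e≤length : e ≤ length xs
  e≤length = begin
    e                          ≡⟨ length-upTo e ⟨
    length (upTo e)            ≡⟨ length-map suc (upTo e) ⟨
    length (map suc (upTo e))  ≤⟨ unique-⊆⇒length≤ (Unique.map⁺ suc-injective (Unique.upTo⁺ e)) sub ⟩
    length xs                  ∎
    where
    sub : ∀ {v} → v ∈ map suc (upTo e) → v ∈ xs
    sub v∈ with v' , v'∈ , refl ← ∈-map⁻ suc v∈ = smaller v' (∈-upTo⁻ v'∈)

∈-justs⁺ : ∀ {v ms} → just v ∈ ms → v ∈ justs ms
∈-justs⁺ (here refl) = here refl
∈-justs⁺ {ms = just _ ∷ _} (there p) = there (∈-justs⁺ p)
∈-justs⁺ {ms = nothing ∷ _} (there p) = ∈-justs⁺ p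

∈-justs⁻ : ∀ {v ms} → v ∈ justs ms → just v ∈ ms
∈-justs⁻ {ms = just _ ∷ _} (here refl) = here refl
∈-justs⁻ {ms = just _ ∷ _} (there p) = there (∈-justs⁻ p)
∈-justs⁻ {ms = nothing ∷ _} p = there (∈-justs⁻ p)

module _ (col : Coloring n) {i j : Fin n} {v : ℕ} where

  ∈-usedAt-row : ∀ j' → col i j' ≡ just v → v ∈ usedAt col i j
  ∈-usedAt-row j' eq = ∈-justs⁺ (∈-++⁺ˡ (subst (_∈ map (col i) (allFin n)) eq (∈-map⁺ (col i) (∈-allFin j'))))

  ∈-usedAt-column : ∀ i' → col i' j ≡ just v → v ∈ usedAt col i j
  ∈-usedAt-column i' eq = ∈-justs⁺ (∈-++⁺ʳ (map (col i) (allFin n)) (subst (_∈ map (λ i' → col i' j) (allFin n)) eq (∈-map⁺ (λ i' → col i' j) (∈-allFin i'))))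

  ∈-usedAt⁻ : v ∈ usedAt col i j → (∃[ j' ] col i j' ≡ just v) ⊎ (∃[ i' ] col i' j ≡ just v)
  ∈-usedAt⁻ v∈ with ∈-++⁻ (map (col i) (allFin n)) (∈-justs⁻ v∈)
  ... | inj₁ p with j' , _ , eq ← ∈-map⁻ (col i) p = inj₁ (j' , sym eq)
  ... | inj₂ p with i' , _ , eq ← ∈-map⁻ (λ i' → col i' j) p = inj₂ (i' , sym eq)

-- If `v` were missed, punching it out of the codomain would inject `Fin (suc n)` into `Fin n`.
injective⇒surjective : {f : Fin n → Fin n} → Injective _≡_ _≡_ f → ∀ v → ∃[ i ] f i ≡ v
injective⇒surjective {suc n} {f} inj v with Fin.any? (λ i → f i Fin.≟ v)
... | yes found = found
... | no missed = contradiction (Fin.injective⇒≤ {f = λ i → Fin.punchOut {i = v} (λ eq → missed (i , sym eq))}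
                    (λ eq → inj (Fin.punchOut-injective {i = v} (λ eq → missed (_ , sym eq)) (λ eq → missed (_ , sym eq)) eq))) 1+n≰n

_≺_ : Rel (Fin n × Fin n) 0ℓ
(i , j) ≺ (i' , j') = i Fin.< i' ⊎ (i ≡ i' × j Fin.< j')

≺-irrefl : {c : Fin n × Fin n} → ¬ (c ≺ c)
≺-irrefl (inj₁ i<i) = <-irrefl refl i<i
≺-irrefl (inj₂ (_ , j<j)) = <-irrefl refl j<j

cells-sorted : ∀ n → AllPairs _≺_ (cells n)
cells-sorted n = AllPairs.concat⁺
  (All.map⁺ (All.tabulate (λ _ → AllPairs.map⁺ (AllPairs.map (λ j<j' → inj₂ (refl , j<j')) (allFin-sorted n)))))
  (AllPairs.map⁺ (AllPairs.map (λ i<i' → All.map⁺ (All.tabulate λ _ → All.map⁺ (All.tabulate λ _ → inj₁ i<i'))) (allFin-sorted n)))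

update-same : (col : Coloring n) (i j : Fin n) (v : ℕ) → update col i j v i j ≡ just v
update-same col i j v with i Fin.≟ i | j Fin.≟ j
... | yes _ | yes _ = refl
... | no i≢ | _ = contradiction refl i≢
... | yes _ | no j≢ = contradiction refl j≢

update-other : (col : Coloring n) {i j i' j' : Fin n} (v : ℕ) → (i' , j') ≢ (i , j) → update col i j v i' j' ≡ col i' j'
update-other col {i} {j} {i'} {j'} v c≢ with i Fin.≟ i' | j Fin.≟ j'
... | yes refl | yes refl = contradiction refl c≢
... | yes _ | no _ = refl
... | no _ | _ = refl

module _ (L : Square n) (latin : IsLatin L) (D : CellSet n)
         (D-row : ∀ i j j' → j Fin.< j' → D i j ≡ false → D i j' ≡ false → L i j' ∉ below L i j) where

  private
    row = proj₁ latin
    column = proj₂ latin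

    -- `Done` and `Pending` form the invariant of the fold, with `rest` the cells still to be
    -- processed. `Done` alone would let a waiting cell hold a wrong colour; `Pending` rules this
    -- out.
    Done : Coloring n → List (Fin n × Fin n) → Set
    Done col rest = ∀ i j → col i j ≡ just (entry L i j) ⊎ (D i j ≡ false × (i , j) ∈ rest)

    Pending : Coloring n → List (Fin n × Fin n) → Set
    Pending col rest = ∀ i j → D i j ≡ false → (i , j) ∈ rest → col i j ≡ nothing

    entry-injective : ∀ {i j i' j'} → entry L i j ≡ entry L i' j' → L i j ≡ L i' j'
    entry-injective eq = Fin.toℕ-injective (suc-injective eq)

    later-in-row : ∀ {i j j' : Fin n} {rest} → All ((i , j) ≺_) rest → (i , j') ∈ rest → j Fin.< j'
    later-in-row later j'∈ with All.lookup later j'∈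
    ... | inj₁ i<i = contradiction i<i (<-irrefl refl)
    ... | inj₂ (_ , j<j') = j<j'

    later-in-column : ∀ {i j i' : Fin n} {rest} → All ((i , j) ≺_) rest → (i' , j) ∈ rest → i Fin.< i'
    later-in-column later i'∈ with All.lookup later i'∈
    ... | inj₁ i<i' = i<i'
    ... | inj₂ (_ , j<j) = contradiction j<j (<-irrefl refl)

    coloured : ∀ {col rest} → Done col rest → Pending col rest → ∀ {i j v} → col i j ≡ just v → entry L i j ≡ v
    coloured done pending {i} {j} eq with done i j
    ... | inj₁ eq' = just-injective (trans (sym eq') eq)
    ... | inj₂ (Df , c∈) with () ← trans (sym eq) (pending i j Df c∈)

    mex-correct : ∀ {i j rest} (col : Coloring n) → Done col ((i , j) ∷ rest) → Pending col ((i , j) ∷ rest) →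
      All ((i , j) ≺_) rest → D i j ≡ false → mexPos (usedAt col i j) ≡ entry L i j
    mex-correct {i} {j} {rest} col done pending later Df = mexPos-least (toℕ (L i j)) _ smaller fresh
      where
      uncoloured : ∀ {v} → col i j ≢ just v
      uncoloured eq with () ← trans (sym eq) (pending i j Df (here refl))

      fresh : entry L i j ∉ usedAt col i j
      fresh e∈ with ∈-usedAt⁻ col e∈
      ... | inj₁ (j' , eq) with refl ← row i (entry-injective (coloured done pending eq)) = uncoloured eq
      ... | inj₂ (i' , eq) with refl ← column j (entry-injective (coloured done pending eq)) = uncoloured eq

      smaller : ∀ v → v < toℕ (L i j) → suc v ∈ usedAt col i j
      -- The symbol `w` is the one whose entry is `suc v`; `(i , j')` and `(i' , j)` are the cells
      -- carrying it in the row and in the column.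
      smaller v v<e with injective⇒surjective (row i) w | injective⇒surjective (column j) w
        where w = fromℕ< (<-trans v<e (Fin.toℕ<n (L i j)))
      ... | j' , eqʳ | i' , eqᶜ with done i j' | done i' j
      ... | inj₁ eq | _ = ∈-usedAt-row col j' (trans eq (cong (just ∘ suc) (trans (cong toℕ eqʳ) (Fin.toℕ-fromℕ< _))))
      ... | inj₂ _ | inj₁ eq = ∈-usedAt-column col i' (trans eq (cong (just ∘ suc) (trans (cong toℕ eqᶜ) (Fin.toℕ-fromℕ< _))))
      -- An occurrence at `(i , j)` itself would make its entry `suc v`, contrary to
      -- `v < toℕ (L i j)`.
      ... | inj₂ (_ , here refl) | inj₂ _ = contradiction (sym (trans (cong toℕ eqʳ) (Fin.toℕ-fromℕ< _))) (<⇒≢ v<e)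
      ... | inj₂ (_ , there _) | inj₂ (_ , here refl) = contradiction (sym (trans (cong toℕ eqᶜ) (Fin.toℕ-fromℕ< _))) (<⇒≢ v<e)
      -- Both occurrences come later in the order, hence to the right and below, so `L i j'` would
      -- lie in `below L i j`.
      ... | inj₂ (Df' , there j'∈) | inj₂ (_ , there i'∈) =
        contradiction (subst (_∈ below L i j) (trans eqᶜ (sym eqʳ)) (∈-map⁺ (λ r → L r j) (∈-drop-tabulate {n} id (later-in-column later i'∈))))
          (D-row i j j' (later-in-row later j'∈) Df Df')

    foldl-correct : ∀ rest col → AllPairs _≺_ rest → Done col rest → Pending col rest →
      ∀ i j → foldl (greedyStep D) col rest i j ≡ just (entry L i j)
    foldl-correct [] col _ done _ i j with done i j
    ... | inj₁ eq = eq
    foldl-correct ((i , j) ∷ rest) col (later ∷ sorted) done pending with D i j in Dij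
    ... | true = foldl-correct rest col sorted done' (λ i' j' Df c∈ → pending i' j' Df (there c∈))
      where
      done' : Done col rest
      done' i' j' with done i' j'
      ... | inj₁ eq = inj₁ eq
      ... | inj₂ (Df , there c∈) = inj₂ (Df , c∈)
      ... | inj₂ (Df , here refl) with () ← trans (sym Dij) Df
    ... | false rewrite mex-correct col done pending later Dij = foldl-correct rest col' sorted done' pending'
      where
      col' : Coloring n
      col' = update col i j (entry L i j)

      -- The order is strict, so the cell just coloured does not recur in `rest` and the waiting
      -- cells stay blank.
      pending' : Pending col' rest
      pending' i' j' Df c∈ = trans (update-other col {i} {j} (entry L i j) (λ { refl → ≺-irrefl (All.lookup later c∈) })) (pending i' j' Df (there c∈))

      updated : ∀ i' j' → (i' , j') ≡ (i , j) → col' i' j' ≡ just (entry L i' j')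
      updated _ _ refl = update-same col i j _

      done' : Done col' rest
      done' i' j' with ≡-dec Fin._≟_ Fin._≟_ (i' , j') (i , j) | done i' j'
      ... | yes eq | _ = inj₁ (updated i' j' eq)
      ... | no c≢ | inj₁ eq = inj₁ (trans (update-other col _ c≢) eq)
      ... | no c≢ | inj₂ (_ , here eq) = contradiction eq c≢
      ... | no _ | inj₂ (Df , there c∈) = inj₂ (Df , c∈)

  greedy-correct : IsGreedyDefiningSet L D
  greedy-correct = foldl-correct (cells n) (initial L D) (cells-sorted n) done pending
    where
    pending : Pending (initial L D) (cells n)
    pending i j Df _ rewrite Df = refl
    done : Done (initial L D) (cells n)
    done i j with D i j
    ... | true = inj₁ refl
    ... | false = inj₂ (refl , ∈-concat⁺′ (∈-map⁺ (i ,_) (∈-allFin j)) (∈-map⁺ (λ i → map (i ,_) (allFin n)) (∈-allFin i)))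

-- Counting the cells outside the defining set

length-cells : ∀ n → length (cells n) ≡ n * n
length-cells n = trans (go (allFin n)) (cong (_* n) (length-tabulate {n = n} id))
  where
  go : (is : List (Fin n)) → length (concatMap (λ i → map (i ,_) (allFin n)) is) ≡ length is * n
  go [] = refl
  go (i ∷ is) = trans (length-++ (map (i ,_) (allFin n)))
    (cong₂ _+_ (trans (length-map (i ,_) (allFin n)) (length-tabulate {n = n} id)) (go is))

-- The elements of `S i` give distinct cells of row `i` outside `D`. Cells inside and outside `D`
-- partition all `n * n` cells, so the truncated subtraction is exact.
complement-size : (D : CellSet n) (S : Fin n → List (Fin n)) →
  (∀ i → Unique (S i)) → (∀ i {j} → j ∈ S i → D i j ≡ false) →
  sum (tabulate (length ∘ S)) ≤ n * n ∸ size D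
complement-size {n} D S unique S⊆ = begin
  sum (tabulate (length ∘ S))                                        ≤⟨ sum-tabulate-mono row-bound ⟩
  sum (tabulate (length ∘ filter (¬? ∘ inD?) ∘ rowCells))            ≡⟨ cong sum (map-tabulate id (length ∘ filter (¬? ∘ inD?) ∘ rowCells)) ⟨
  sum (map (length ∘ filter (¬? ∘ inD?) ∘ rowCells) (allFin n))      ≡⟨ length-filter-concatMap (¬? ∘ inD?) rowCells (allFin n) ⟨
  length (filter (¬? ∘ inD?) (cells n))                              ≡⟨ m+n∸m≡n (size D) _ ⟨
  size D + length (filter (¬? ∘ inD?) (cells n)) ∸ size D            ≡⟨ cong (_∸ size D) (length-filter-complement inD? (cells n)) ⟩
  length (cells n) ∸ size D                                          ≡⟨ cong (_∸ size D) (length-cells n) ⟩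
  n * n ∸ size D                                                     ∎
  where
  open ≤-Reasoning
  inD? : Decidable (λ (c : Fin n × Fin n) → D (proj₁ c) (proj₂ c) ≡ true)
  inD? c = D (proj₁ c) (proj₂ c) Bool.≟ true

  rowCells : Fin n → List (Fin n × Fin n)
  rowCells i = map (i ,_) (allFin n)

  row-bound : ∀ i → length (S i) ≤ length (filter (¬? ∘ inD?) (rowCells i))
  row-bound i = subst (_≤ length (filter (¬? ∘ inD?) (rowCells i))) (length-map (i ,_) (S i))
    (unique-⊆⇒length≤ (Unique.map⁺ (cong proj₂) (unique i)) sub)
    where
    sub : ∀ {c} → c ∈ map (i ,_) (S i) → c ∈ filter (¬? ∘ inD?) (rowCells i)
    sub c∈ with j , j∈ , refl ← ∈-map⁻ (i ,_) c∈ =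
      ∈-filter⁺ (¬? ∘ inD?) (∈-map⁺ (i ,_) (∈-allFin j)) λ Dt → contradiction (trans (sym Dt) (S⊆ i j∈)) λ ()

-- The harmonic sum

-- `X` is the sum of the first `a` terms. Each of their denominators is at most `a + b`, so each
-- term is at least `N / (a + b)`.
sum-split : ∀ N a b (g : Fin (a + b) → ℕ) → (∀ i → N ≤ (a + b ∸ toℕ i) * g i) →
  ∃[ X ] sum (tabulate g) ≡ X + sum (tabulate (g ∘ (a ↑ʳ_))) × a * N ≤ (a + b) * X
sum-split N zero b g large = 0 , refl , z≤n
sum-split N (suc a) b g large with X , eq , bound ← sum-split N a b (g ∘ suc) (large ∘ suc)
  = g zero + X , trans (cong (g zero +_) eq) (sym (+-assoc (g zero) X _)) , (begin
    N + a * N                                      ≤⟨ +-mono-≤ (large zero) bound ⟩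
    suc (a + b) * g zero + (a + b) * X             ≤⟨ +-monoʳ-≤ _ (*-monoˡ-≤ X (n≤1+n (a + b))) ⟩
    suc (a + b) * g zero + suc (a + b) * X         ≡⟨ *-distribˡ-+ (suc (a + b)) (g zero) X ⟨
    suc (a + b) * (g zero + X)                     ∎)
  where open ≤-Reasoning

-- The denominators are counted from the end, so dropping the first `a` terms leaves a hypothesis of
-- the same form.
large-tail : ∀ N a b (g : Fin (a + b) → ℕ) → (∀ i → N ≤ (a + b ∸ toℕ i) * g i) →
  ∀ i → N ≤ (b ∸ toℕ i) * g (a ↑ʳ i)
large-tail N a b g large i = subst (λ t → N ≤ t * g (a ↑ʳ i))
  (trans (cong (a + b ∸_) (Fin.toℕ-↑ʳ a i)) ([m+n]∸[m+o]≡n∸o a b (toℕ i))) (large (a ↑ʳ i))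

-- Doubling the length adds a first half whose sum `X` satisfies `N ≤ 2 * X`; the second half falls
-- to induction. The single term at `k = 0` supplies the constant 2. The equation for `b` is needed
-- because the second half has length `2 ^ k + 0`.
harmonic-2^k : ∀ N k b → b ≡ 2 ^ k → (g : Fin b → ℕ) → (∀ i → N ≤ (b ∸ toℕ i) * g i) →
  N * (2 + k) ≤ 2 * sum (tabulate g)
harmonic-2^k N zero _ refl g large = begin
  N * 2                  ≡⟨ *-comm N 2 ⟩
  2 * N                  ≤⟨ *-monoʳ-≤ 2 (large zero) ⟩
  2 * (g zero + 0)       ∎
  where open ≤-Reasoning
harmonic-2^k N (suc k) _ refl g large with X , eq , bound ← sum-split N (2 ^ k) (2 ^ k + 0) g large
  = begin
    N * (3 + k)                ≡⟨ *-suc N (2 + k) ⟩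
    N + N * (2 + k)            ≤⟨ +-mono-≤ N≤2X (harmonic-2^k N k (2 ^ k + 0) (+-identityʳ (2 ^ k)) _ (large-tail N (2 ^ k) _ g large)) ⟩
    2 * X + 2 * R              ≡⟨ *-distribˡ-+ 2 X R ⟨
    2 * (X + R)                ≡⟨ cong (2 *_) eq ⟨
    2 * sum (tabulate g)       ∎
  where
  open ≤-Reasoning
  R = sum (tabulate (g ∘ (2 ^ k ↑ʳ_)))
  regroup : ∀ a x → (a + (a + 0)) * x ≡ a * (2 * x)
  regroup = solve-∀
  N≤2X : N ≤ 2 * X
  N≤2X = *-cancelˡ-≤ (2 ^ k) {{m^n≢0 2 k}} (subst (2 ^ k * N ≤_) (regroup (2 ^ k) X) bound)

-- Only the last `2 ^ k` terms are kept, those with denominators from `2 ^ k` down to 1.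
harmonic : ∀ N k n → 2 ^ k ≤ n → (g : Fin n → ℕ) → (∀ i → N ≤ (n ∸ toℕ i) * g i) →
  N * (2 + k) ≤ 2 * sum (tabulate g)
harmonic N k n 2^k≤n g large = shifted (n ∸ 2 ^ k) n (sym (m∸n+n≡m 2^k≤n)) g large
  where
  open ≤-Reasoning
  -- Taking `n` as a variable lets `refl` replace it by `a + 2 ^ k`, the form that `sum-split`
  -- expects.
  shifted : ∀ a n → n ≡ a + 2 ^ k → (g : Fin n → ℕ) → (∀ i → N ≤ (n ∸ toℕ i) * g i) →
    N * (2 + k) ≤ 2 * sum (tabulate g)
  shifted a _ refl g large with X , eq , _ ← sum-split N a (2 ^ k) g large = begin
    N * (2 + k)                             ≤⟨ harmonic-2^k N k (2 ^ k) refl _ (large-tail N a (2 ^ k) g large) ⟩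
    2 * sum (tabulate (g ∘ (a ↑ʳ_)))        ≤⟨ *-monoʳ-≤ 2 (m≤n+m _ X) ⟩
    2 * (X + sum (tabulate (g ∘ (a ↑ʳ_))))  ≡⟨ cong (2 *_) eq ⟨
    2 * sum (tabulate g)                    ∎

-- The exponential series

-- The left side consists of the two leading terms of the binomial expansion. The induction
-- multiplies by `suc x` and drops the surplus `suc k * x ^ k`.
bernoulli : ∀ x k → x ^ suc k + suc k * x ^ k ≤ suc x ^ suc k
bernoulli x zero = ≤-reflexive (eq x)
  where
  eq : ∀ x → x * 1 + (1 + 0) ≡ suc x * 1
  eq = solve-∀
bernoulli x (suc k) = begin
  x * (x * p) + (2 + k) * (x * p)                           ≤⟨ m≤m+n _ (suc k * p) ⟩
  x * (x * p) + (2 + k) * (x * p) + suc k * p               ≡⟨ eq x k p ⟩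
  suc x * (x * p + suc k * p)                               ≤⟨ *-monoʳ-≤ (suc x) (bernoulli x k) ⟩
  suc x * suc x ^ suc k                                     ∎
  where
  open ≤-Reasoning
  p = x ^ k
  eq : ∀ x k p → x * (x * p) + (2 + k) * (x * p) + suc k * p ≡ suc x * (x * p + suc k * p)
  eq = solve-∀

-- For `x ≥ 1`, `bernoulli` gives `2 * x ^ x ≤ suc x ^ x`; multiplied by `suc x`, this is the growth
-- that the induction needs.
2^x*x!≤2*x^x : ∀ x → 2 ^ x * (x !) ≤ 2 * x ^ x
2^x*x!≤2*x^x zero = s≤s z≤n
-- The inductive step fails from 0 to 1, as `2 * 0 ^ 0` exceeds `1 ^ 0`, so 1 is a base case of its
-- own. Equality holds there.
2^x*x!≤2*x^x (suc zero) = ≤-refl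
2^x*x!≤2*x^x (suc x@(suc k)) = begin
  2 * 2 ^ x * (suc x * (x !))                ≡⟨ eq₁ (2 ^ x) (suc x) (x !) ⟩
  2 * (suc x * (2 ^ x * (x !)))              ≤⟨ *-monoʳ-≤ 2 (*-monoʳ-≤ (suc x) (2^x*x!≤2*x^x x)) ⟩
  2 * (suc x * (2 * x ^ x))                  ≡⟨ cong (λ t → 2 * (suc x * t)) (eq₂ (x ^ x)) ⟩
  2 * (suc x * (x ^ x + x * x ^ k))          ≤⟨ *-monoʳ-≤ 2 (*-monoʳ-≤ (suc x) (bernoulli x k)) ⟩
  2 * (suc x * suc x ^ x)                    ∎
  where
  open ≤-Reasoning
  eq₁ : ∀ a b c → 2 * a * (b * c) ≡ 2 * (b * (a * c))
  eq₁ = solve-∀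
  eq₂ : ∀ a → 2 * a ≡ a + a
  eq₂ = solve-∀

-- Truncating at `J = x` scales the series by `x !`, so its last term becomes exactly `x ^ x`.
x^x≤expPartialScaled : ∀ x → x ^ x ≤ expPartialScaled x x
x^x≤expPartialScaled x = begin
  x ^ x                            ≡⟨ *-identityʳ (x ^ x) ⟨
  x ^ x * 1                        ≡⟨ cong (λ k → x ^ x * risingFrom x k) (n∸n≡0 x) ⟨
  x ^ x * risingFrom x (x ∸ x)     ≤⟨ ∈-sum (∈-map⁺ (λ j → x ^ j * risingFrom j (x ∸ j)) (∈-upTo⁺ (n<1+n x))) ⟩
  expPartialScaled x x             ∎
  where open ≤-Reasoning

log₂-bracket : ∀ n → 1 ≤ n → ∃[ k ] 2 ^ k ≤ n × n < 2 ^ suc k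
log₂-bracket (suc zero) _ = 0 , ≤-refl , ≤-refl
log₂-bracket (suc n@(suc _)) _ with k , lower , upper ← log₂-bracket n (s≤s z≤n) | m≤n⇒m<n∨m≡n upper
... | inj₁ n<2^ = k , m≤n⇒m≤1+n lower , n<2^
... | inj₂ eq = suc k , ≤-reflexive (sym eq) , subst (_< 2 ^ suc (suc k)) (sym eq) (^-monoʳ-< 2 ≤-refl (n<1+n (suc k)))

-- With `x = 4 * m` also as the truncation index, `4 * n ≤ 2 ^ (3 + k)` reduces the claim to
-- `2 ^ ((3 + k) * n) * x ! ≤ x ^ x`, which `2^x*x!≤2*x^x` gives once `x` exceeds `(3 + k) * n`.
atLeast-of-dyadic : ∀ n m k → 1 ≤ n → n < 2 ^ suc k → n * (2 + k) ≤ 2 * m → AtLeastQuarterNLog4N n m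
atLeast-of-dyadic n m k 1≤n n<2^ bound = x , (begin
  (4 * n) ^ n * (x !)                      ≤⟨ *-monoˡ-≤ (x !) (^-monoˡ-≤ n (*-monoʳ-≤ 4 (<⇒≤ n<2^))) ⟩
  (4 * 2 ^ suc k) ^ n * (x !)              ≡⟨ cong (λ t → t ^ n * (x !)) (eq₁ (2 ^ suc k)) ⟩
  (2 ^ (3 + k)) ^ n * (x !)                ≡⟨ cong (_* (x !)) (^-*-assoc 2 (3 + k) n) ⟩
  2 ^ ((3 + k) * n) * (x !)                ≤⟨ *-cancelˡ-≤ 2 doubled ⟩
  x ^ x                                    ≤⟨ x^x≤expPartialScaled x ⟩
  expPartialScaled x x                     ∎)
  where
  open ≤-Reasoning
  x = 4 * m
  eq₁ : ∀ t → 4 * t ≡ 2 * (2 * t)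
  eq₁ = solve-∀
  eq₂ : ∀ n k → (3 + k) * n + n + k * n ≡ 2 * (n * (2 + k))
  eq₂ = solve-∀
  eq₃ : ∀ m → 2 * (2 * m) ≡ 4 * m
  eq₃ = solve-∀
  -- The hypothesis gives `x ≥ (4 + 2 * k) * n`. The extra 1, available because `1 ≤ n`, absorbs the
  -- factor 2 in `2^x*x!≤2*x^x`.
  exponent : suc ((3 + k) * n) ≤ x
  exponent = begin
    1 + (3 + k) * n                    ≡⟨ +-comm 1 ((3 + k) * n) ⟩
    (3 + k) * n + 1                    ≤⟨ +-monoʳ-≤ ((3 + k) * n) 1≤n ⟩
    (3 + k) * n + n                    ≤⟨ m≤m+n _ (k * n) ⟩
    (3 + k) * n + n + k * n            ≡⟨ eq₂ n k ⟩
    2 * (n * (2 + k))                  ≤⟨ *-monoʳ-≤ 2 bound ⟩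
    2 * (2 * m)                        ≡⟨ eq₃ m ⟩
    4 * m                              ∎
  doubled : 2 * (2 ^ ((3 + k) * n) * (x !)) ≤ 2 * x ^ x
  doubled = begin
    2 * (2 ^ ((3 + k) * n) * (x !))    ≡⟨ *-assoc 2 (2 ^ ((3 + k) * n)) (x !) ⟨
    2 ^ suc ((3 + k) * n) * (x !)      ≤⟨ *-monoˡ-≤ (x !) (^-monoʳ-≤ 2 exponent) ⟩
    2 ^ x * (x !)                      ≤⟨ 2^x*x!≤2*x^x x ⟩
    2 * x ^ x                          ∎

-- Assembling the defining set from its rows

theorem5 : (n : ℕ) → 1 ≤ n → (L : Square n) → IsLatin L →
    Σ (CellSet n) (λ D → IsGreedyDefiningSet L D × AtLeastQuarterNLog4N n (n * n ∸ size D))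
theorem5 n 1≤n L latin =
  -- The lower half of the bracket feeds the harmonic estimate, the upper half the comparison with
  -- the exponential series.
  let k , lower , upper = log₂-bracket n 1≤n
  in D , greedy-correct L latin D D-row
   , atLeast-of-dyadic n (n * n ∸ size D) k 1≤n upper
       (≤-trans (harmonic n k n lower (length ∘ S) (λ i → proj₂ (S-row i)))
         (*-monoʳ-≤ 2 (complement-size D S (λ i → <-sorted⇒unique (AllPairs.map proj₁ (proj₁ (S-row i)))) S⇒¬D)))
  where
  open DecMembership (Fin._≟_ {n}) using (_∈?_)

  S : Fin n → List (Fin n)
  S i = proj₁ (rowSet L latin i)

  S-row : ∀ i → RowSet L i (S i)
  S-row i = proj₂ (rowSet L latin i)

  D : CellSet n
  D i j = not (does (j ∈? S i))

  S⇒¬D : ∀ i {j} → j ∈ S i → D i j ≡ false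
  S⇒¬D i {j} j∈ = cong not (dec-true (j ∈? S i) j∈)

  ¬D⇒S : ∀ i j → D i j ≡ false → j ∈ S i
  ¬D⇒S i j Df with yes j∈ ← j ∈? S i = j∈

  D-row : ∀ i j j' → j Fin.< j' → D i j ≡ false → D i j' ≡ false → L i j' ∉ below L i j
  D-row i j j' j<j' Df Df' with AllPairs-∈ (proj₁ (S-row i)) (¬D⇒S i j Df) (¬D⇒S i j' Df')
  ... | inj₁ refl = contradiction j<j' (<-irrefl refl)
  ... | inj₂ (inj₁ (_ , ok)) = ok
  ... | inj₂ (inj₂ (j'<j , _)) = contradiction j<j' (<-asym j'<j)
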